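{- Let $\lambda\in\mathbb{C}$. For any function $g(x)=f(x^{ -1})$, with $f(x)$ a polynomial of degree $n$, and a non-zero real number $a$, we have the following $\lambda$-Taylor expansion: $$f(x^{ -1})=\sum_{k=0}^{n}c_k\,(x-a)_\lambda^k,$$ where $$c_0=g(a),\qquad c_1=\frac{\lambda(\widehat{\mathrm{I}}_\lambda g)(a)-a\,g(a)}{a(1-\lambda)},\qquad\ldots,\qquad c_n=\frac{\lambda^{\binom{n+1}{2}}(\widehat{\mathrm{I}}_\lambda^{n}g)(a)}{a^n(\lambda;\lambda)_n}-\sum_{i=1}^{n-1}\frac{c_i}{(\lambda;\lambda)_{n-i}},$$ the coefficients $c_m$ with $2\le m<n$ being given by the last formula with $m$ in place of $n$.
   Context: $(x-a)_\lambda^0=1$ and $(x-a)_\lambda^k=\prod_{j=0}^{k-1}\left(1-\frac{a}{\lambda^j x}\right)$ for $k\ge 1$ (this is a function of $x$ and $a$, not an ordinary power). $(\lambda;\lambda)_0=1$ and $(\lambda;\lambda)_m=\prod_{j=1}^{m}(1-\lambda^j)$ for $m\ge1$. The $\lambda$-integral operator is $(\widehat{\mathrm{I}}_\lambda g)(x)=\frac{x}{\lambda}g\left(\frac{x}{\lambda}\right)$, provided that $g(x/\lambda)$ exists, and $\widehat{\mathrm{I}}_\lambda^m$ is its $m$-fold iterate.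
   Formalization: The sum in the formula for c_m (2 ≤ m ≤ n) runs from i=0 instead of i=1, since the printed formula fails when g(a)≠0 (e.g. f=x², λ=2, a=1); λ≠0 and λ^j≠1 for 1≤j≤n are assumed so that the divisions make sense. -}

module Defs where

open import Algebra.Apartness.Bundles using (HeytingCommutativeRing; HeytingField)
import Algebra.Apartness.Properties.HeytingCommutativeRing as HeytingCommutativeRingProperties
open import Algebra.Bundles using (CommutativeRing; Semiring)
open import Algebra.Structures using (IsCommutativeRing)
open import Data.Fin.Base using (zero; suc; toℕ)
open import Data.Fin.Properties using (toℕ<n)
open import Data.Integer.Base using (+_)
open import Data.Nat.Base as ℕ using (ℕ; zero; suc; z≤n; s≤s)
open import Data.Nat.Combinatorics using (_C_)
open import Data.Nat.GeneralisedArithmetic using (fold)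
import Data.Nat.Properties as ℕ
open import Data.Product.Base using (Σ; ∃-syntax; _×_; _,_; proj₁; proj₂)
open import Data.Sum.Base as Sum using (_⊎_; inj₁; inj₂)
open import Data.Vec.Functional using (Vector)
open import Function.Base using (_∘_; const)
open import Level using (_⊔_; 0ℓ)
open import Relation.Binary.PropositionalEquality.Core
  using (_≡_; _≢_; refl; sym; trans; cong; cong₂; subst)
open import Relation.Nullary.Decidable.Core using (Dec; yes; no)
open import Relation.Nullary.Negation.Core using (¬_; contradiction)

-- ℝ as Cauchy sequences of rationals and ℂ = ℝ × ℝ, both proved to be Heyting fields.
module Numbers where

  open import Data.Rational.Base
  open import Data.Rational.Properties
  open import Data.Rational.Solver using (module +-*-Solver)

  module ℚ-Lemmas where
    open +-*-Solver

    +-cancelʳ-< : ∀ r {p q} → p + r < q + r → p < q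
    +-cancelʳ-< r {p} {q} h =
      subst (λ t → t < q) (lem p) (subst (p + r - r <_) (lem q) (+-monoˡ-< (- r) h))
      where
      lem : ∀ p → p + r - r ≡ p
      lem = solve 2 (λ r p → p :+ r :- r := p) refl r

    ∣-∣-sym : ∀ p q → ∣ p - q ∣ ≡ ∣ q - p ∣
    ∣-∣-sym p q = trans (sym (∣-p∣≡∣p∣ (p - q)))
      (cong ∣_∣ (solve 2 (λ p q → :- (p :- q) := q :- p) refl p q))

    triangle : ∀ p q r → ∣ p - r ∣ ≤ ∣ p - q ∣ + ∣ q - r ∣
    triangle p q r = ≤-trans
      (≤-reflexive (cong ∣_∣ (solve 3 (λ p q r → p :- r := (p :- q) :+ (q :- r)) refl p q r)))
      (∣p+q∣≤∣p∣+∣q∣ (p - q) (q - r))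

    0<* : ∀ {p q} → 0ℚ < p → 0ℚ < q → 0ℚ < p * q
    0<* {p} {q} 0<p 0<q = positive⁻¹ (p * q) {{pos*pos⇒pos p {{positive 0<p}} q {{positive 0<q}}}}

    *-mono-<-nonNeg : ∀ {p q r s} → 0ℚ ≤ p → 0ℚ ≤ r → p < q → r < s → p * r < q * s
    *-mono-<-nonNeg {p} {q} {r} {s} 0≤p 0≤r p<q r<s = ≤-<-trans
      (*-monoʳ-≤-nonNeg r {{nonNegative 0≤r}} (<⇒≤ p<q))
      (*-monoʳ-<-pos q {{positive (≤-<-trans 0≤p p<q)}} r<s)

    recip : ℚ → ℚ
    recip p with p ≟ 0ℚ
    ... | yes _   = 0ℚ
    ... | no p≢0 = 1/_ p {{≢-nonZero p≢0}}

    recip-* : ∀ p → p ≢ 0ℚ → recip p * p ≡ 1ℚ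
    recip-* p p≢0 with p ≟ 0ℚ
    ... | yes p≡0 = contradiction p≡0 p≢0
    ... | no p≢0′ = *-inverseˡ p {{≢-nonZero p≢0′}}

    0<recip : ∀ {p} → 0ℚ < p → 0ℚ < recip p
    0<recip {p} 0<p with p ≟ 0ℚ
    ... | yes refl = contradiction 0<p (<-irrefl refl)
    ... | no p≢0 = positive⁻¹ _ {{1/pos⇒pos p {{positive 0<p}}}}

    <∣p∣⇒≢0 : ∀ {ε p} → 0ℚ < ε → ε < ∣ p ∣ → p ≢ 0ℚ
    <∣p∣⇒≢0 0<ε ε<∣p∣ refl = <-irrefl refl (<-trans 0<ε ε<∣p∣)

    ⅛ : ℚ
    ⅛ = + 1 / 8

    0<½ : 0ℚ < ½
    0<½ = positive⁻¹ ½

    0<⅛ : 0ℚ < ⅛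
    0<⅛ = positive⁻¹ ⅛

    0<1 : 0ℚ < 1ℚ
    0<1 = positive⁻¹ 1ℚ

  open ℚ-Lemmas

  Null : (ℕ → ℕ → ℚ) → Set
  Null d = ∀ {ε} → 0ℚ < ε → ∃[ N ] (∀ {m n} → N ℕ.≤ m → N ℕ.≤ n → ∣ d m n ∣ < ε)

  module Null-Lemmas where
    open +-*-Solver
    open ≤-Reasoning

    Bounded : (ℕ → ℕ → ℚ) → Set
    Bounded b = ∃[ B ] (0ℚ < B × ∃[ N ] (∀ {m n} → N ℕ.≤ m → N ℕ.≤ n → ∣ b m n ∣ < B))

    ⊔ˡ : ∀ {M N k} → M ℕ.⊔ N ℕ.≤ k → M ℕ.≤ k
    ⊔ˡ {M} {N} = ℕ.≤-trans (ℕ.m≤m⊔n M N)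

    ⊔ʳ : ∀ {M N k} → M ℕ.⊔ N ℕ.≤ k → N ℕ.≤ k
    ⊔ʳ {M} {N} = ℕ.≤-trans (ℕ.m≤n⊔m M N)

    null-ext : ∀ {d e} N → (∀ {m n} → N ℕ.≤ m → N ℕ.≤ n → d m n ≡ e m n) → Null d → Null e
    null-ext N d≡e d→0 {ε} 0<ε with d→0 0<ε
    ... | M , h = M ℕ.⊔ N , λ p q →
      subst (λ t → ∣ t ∣ < ε) (d≡e (⊔ʳ {M} p) (⊔ʳ {M} q)) (h (⊔ˡ {M} p) (⊔ˡ {M} q))

    null-≡ : ∀ {d e} → (∀ m n → d m n ≡ e m n) → Null d → Null e
    null-≡ d≡e = null-ext 0 (λ {m} {n} _ _ → d≡e m n)

    null-0 : Null (λ _ _ → 0ℚ)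
    null-0 0<ε = 0 , λ _ _ → 0<ε

    null-neg : ∀ {d} → Null d → Null (λ m n → - d m n)
    null-neg {d} d→0 {ε} 0<ε with d→0 0<ε
    ... | N , h = N , λ {m} {n} p q → subst (_< ε) (sym (∣-p∣≡∣p∣ (d m n))) (h p q)

    null-swap : ∀ {d} → Null d → Null (λ m n → d n m)
    null-swap d→0 0<ε with d→0 0<ε
    ... | N , h = N , λ p q → h q p

    null-+ : ∀ {d e} → Null d → Null e → Null (λ m n → d m n + e m n)
    null-+ {d} {e} d→0 e→0 {ε} 0<ε with d→0 (0<* 0<½ 0<ε) | e→0 (0<* 0<½ 0<ε)
    ... | M , h | N , k = M ℕ.⊔ N , λ {m} {n} p q → begin-strict
      ∣ d m n + e m n ∣      ≤⟨ ∣p+q∣≤∣p∣+∣q∣ (d m n) (e m n) ⟩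
      ∣ d m n ∣ + ∣ e m n ∣  <⟨ +-mono-< (h (⊔ˡ {M} p) (⊔ˡ {M} q)) (k (⊔ʳ {M} p) (⊔ʳ {M} q)) ⟩
      ½ * ε + ½ * ε          ≡⟨ solve 1 (λ ε → con ½ :* ε :+ con ½ :* ε := ε) refl ε ⟩
      ε                      ∎

    null-* : ∀ {b d} → Bounded b → Null d → Null (λ m n → b m n * d m n)
    null-* {b} {d} (B , 0<B , N , k) d→0 {ε} 0<ε with d→0 (0<* (0<recip 0<B) 0<ε)
    ... | M , h = M ℕ.⊔ N , λ {m} {n} p q → begin-strict
      ∣ b m n * d m n ∣      ≡⟨ ∣p*q∣≡∣p∣*∣q∣ (b m n) (d m n) ⟩
      ∣ b m n ∣ * ∣ d m n ∣  <⟨ *-mono-<-nonNeg (0≤∣p∣ (b m n)) (0≤∣p∣ (d m n))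
                                  (k (⊔ʳ {M} p) (⊔ʳ {M} q)) (h (⊔ˡ {M} p) (⊔ˡ {M} q)) ⟩
      B * (recip B * ε)      ≡⟨ solve 3 (λ B r ε → B :* (r :* ε) := (r :* B) :* ε) refl B (recip B) ε ⟩
      recip B * B * ε        ≡⟨ cong (_* ε) (recip-* B (λ { refl → <-irrefl refl 0<B })) ⟩
      1ℚ * ε                 ≡⟨ *-identityˡ ε ⟩
      ε                      ∎

    bounded-* : ∀ {b c} → Bounded b → Bounded c → Bounded (λ m n → b m n * c m n)
    bounded-* {b} {c} (B , 0<B , M , h) (C , 0<C , N , k) = B * C , 0<* 0<B 0<C , M ℕ.⊔ N ,
      λ {m} {n} p q → begin-strict
        ∣ b m n * c m n ∣      ≡⟨ ∣p*q∣≡∣p∣*∣q∣ (b m n) (c m n) ⟩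
        ∣ b m n ∣ * ∣ c m n ∣  <⟨ *-mono-<-nonNeg (0≤∣p∣ (b m n)) (0≤∣p∣ (c m n))
                                    (h (⊔ˡ {M} p) (⊔ˡ {M} q)) (k (⊔ʳ {M} p) (⊔ʳ {M} q)) ⟩
        B * C                  ∎

    cauchy⇒bounded : ∀ {x : ℕ → ℚ} → Null (λ m n → x m - x n) → Bounded (λ m _ → x m)
    cauchy⇒bounded {x} x-cauchy with x-cauchy 0<1
    ... | N , h = 1ℚ + ∣ x N ∣
      , <-≤-trans 0<1 (≤-trans (≤-reflexive (sym (+-identityʳ 1ℚ))) (+-monoʳ-≤ 1ℚ (0≤∣p∣ (x N))))
      , N , λ {m} p _ → begin-strict
        ∣ x m ∣                ≡⟨ cong ∣_∣ (solve 2 (λ p q → p := (p :- q) :+ q) refl (x m) (x N)) ⟩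
        ∣ x m - x N + x N ∣    ≤⟨ ∣p+q∣≤∣p∣+∣q∣ (x m - x N) (x N) ⟩
        ∣ x m - x N ∣ + ∣ x N ∣  <⟨ +-monoˡ-< ∣ x N ∣ (h p ℕ.≤-refl) ⟩
        1ℚ + ∣ x N ∣           ∎

    bounded-swap : ∀ {b} → Bounded b → Bounded (λ m n → b n m)
    bounded-swap (B , 0<B , N , h) = B , 0<B , N , λ p q → h q p

  open Null-Lemmas

  record ℝ : Set where
    no-eta-equality
    field
      seq    : ℕ → ℚ
      cauchy : Null (λ m n → seq m - seq n)

  open ℝ

  infix 4 _≈ʳ_ _#ʳ_

  -- For Cauchy sequences, xₘ - yₙ → 0 as m, n → ∞ independently iff xₙ - yₙ → 0.
  record _≈ʳ_ (x y : ℝ) : Set where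
    no-eta-equality
    constructor mk≈
    field null : Null (λ m n → seq x m - seq y n)

  -- The constructive reading of x ≠ y; classically equivalent to ¬ x ≈ʳ y.
  record _#ʳ_ (x y : ℝ) : Set where
    no-eta-equality
    pattern
    constructor mk#
    field
      {ε}   : ℚ
      0<ε   : 0ℚ < ε
      {N}   : ℕ
      apart : ∀ {n} → N ℕ.≤ n → ε < ∣ seq x n - seq y n ∣

  open _≈ʳ_

  module ℝ-Cong where
    open +-*-Solver

    seq-+-cong : ∀ {x x′ y y′ : ℕ → ℚ} → Null (λ m n → x m - x′ n) → Null (λ m n → y m - y′ n) →
                 Null (λ m n → (x m + y m) - (x′ n + y′ n))
    seq-+-cong {x} {x′} {y} {y′} p q = null-≡
      (λ m n → solve 4 (λ a b c d → (a :- b) :+ (c :- d) := (a :+ c) :- (b :+ d)) refl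
                 (x m) (x′ n) (y m) (y′ n))
      (null-+ p q)

    seq-neg-cong : ∀ {x x′ : ℕ → ℚ} → Null (λ m n → x m - x′ n) → Null (λ m n → - x m - - x′ n)
    seq-neg-cong {x} {x′} p = null-≡
      (λ m n → solve 2 (λ a b → :- (a :- b) := :- a :- :- b) refl (x m) (x′ n))
      (null-neg p)

    seq-*-cong : ∀ {x x′ y y′ : ℕ → ℚ} → Bounded (λ m _ → x m) → Bounded (λ m _ → y′ m) →
                 Null (λ m n → x m - x′ n) → Null (λ m n → y m - y′ n) →
                 Null (λ m n → x m * y m - x′ n * y′ n)
    seq-*-cong {x} {x′} {y} {y′} bx by′ p q = null-≡
      (λ m n → solve 4 (λ a b c d → a :* (c :- d) :+ d :* (a :- b) := a :* c :- b :* d) refl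
                 (x m) (x′ n) (y m) (y′ n))
      (null-+ (null-* bx q) (null-* (bounded-swap by′) p))

  open ℝ-Cong

  infixl 6 _+ʳ_
  infixl 7 _*ʳ_
  infix  8 -ʳ_

  bdd : ∀ x → Bounded (λ m _ → seq x m)
  bdd x = cauchy⇒bounded {seq x} (cauchy x)

  _+ʳ_ : ℝ → ℝ → ℝ
  (x +ʳ y) .seq n  = seq x n + seq y n
  (x +ʳ y) .cauchy = seq-+-cong {seq x} {seq x} {seq y} (cauchy x) (cauchy y)

  _*ʳ_ : ℝ → ℝ → ℝ
  (x *ʳ y) .seq n  = seq x n * seq y n
  (x *ʳ y) .cauchy = seq-*-cong {seq x} {seq x} {seq y} (bdd x) (bdd y) (cauchy x) (cauchy y)

  -ʳ_ : ℝ → ℝ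
  (-ʳ x) .seq n  = - seq x n
  (-ʳ x) .cauchy = seq-neg-cong {seq x} (cauchy x)

  fromℚ : ℚ → ℝ
  fromℚ p .seq _  = p
  fromℚ p .cauchy = null-≡ (λ _ _ → sym (+-inverseʳ p)) null-0

  0ʳ 1ʳ : ℝ
  0ʳ = fromℚ 0ℚ
  1ʳ = fromℚ 1ℚ

  module ℝ-Properties where
    open +-*-Solver
    open ≤-Reasoning

    pointwise : ∀ {x y} → (∀ n → seq x n ≡ seq y n) → x ≈ʳ y
    pointwise {x} x≡y = mk≈ (null-≡ (λ m n → cong (λ t → seq x m - t) (x≡y n)) (cauchy x))

    ≈-refl : ∀ {x} → x ≈ʳ x
    ≈-refl {x} = mk≈ (cauchy x)

    ≈-sym : ∀ {x y} → x ≈ʳ y → y ≈ʳ x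
    ≈-sym {x} {y} x≈y = mk≈ (null-≡
      (λ m n → solve 2 (λ a b → :- (a :- b) := b :- a) refl (seq x n) (seq y m))
      (null-neg (null-swap (null x≈y))))

    ≈-trans : ∀ {x y z} → x ≈ʳ y → y ≈ʳ z → x ≈ʳ z
    ≈-trans {x} {y} {z} x≈y y≈z = mk≈ (null-≡
      (λ m n → solve 3 (λ a b c → (a :- b) :+ (b :- c) := a :- c) refl
        (seq x m) (seq y m) (seq z n))
      (null-+ diagonal (null y≈z)))
      where
      diagonal : Null (λ m _ → seq x m - seq y m)
      diagonal 0<ε with null x≈y 0<ε
      ... | N , h = N , λ p _ → h p p

    +-cong : ∀ {x x′ y y′} → x ≈ʳ x′ → y ≈ʳ y′ → x +ʳ y ≈ʳ x′ +ʳ y′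
    +-cong {x} {x′} {y} p q = mk≈ (seq-+-cong {seq x} {seq x′} {seq y} (null p) (null q))

    neg-cong : ∀ {x x′} → x ≈ʳ x′ → -ʳ x ≈ʳ -ʳ x′
    neg-cong {x} p = mk≈ (seq-neg-cong {seq x} (null p))

    *-cong : ∀ {x x′ y y′} → x ≈ʳ x′ → y ≈ʳ y′ → x *ʳ y ≈ʳ x′ *ʳ y′
    *-cong {x} {x′} {y} {y′} p q =
      mk≈ (seq-*-cong {seq x} {seq x′} {seq y} (bdd x) (bdd y′) (null p) (null q))

    +ʳ-assoc : ∀ x y z → (x +ʳ y) +ʳ z ≈ʳ x +ʳ (y +ʳ z)
    +ʳ-assoc x y z = pointwise λ n → +-assoc (seq x n) (seq y n) (seq z n)

    +ʳ-comm : ∀ x y → x +ʳ y ≈ʳ y +ʳ x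
    +ʳ-comm x y = pointwise λ n → +-comm (seq x n) (seq y n)

    +ʳ-identityˡ : ∀ x → 0ʳ +ʳ x ≈ʳ x
    +ʳ-identityˡ x = pointwise λ n → +-identityˡ (seq x n)

    +ʳ-inverseˡ : ∀ x → -ʳ x +ʳ x ≈ʳ 0ʳ
    +ʳ-inverseˡ x = pointwise λ n → +-inverseˡ (seq x n)

    *ʳ-assoc : ∀ x y z → (x *ʳ y) *ʳ z ≈ʳ x *ʳ (y *ʳ z)
    *ʳ-assoc x y z = pointwise λ n → *-assoc (seq x n) (seq y n) (seq z n)

    *ʳ-comm : ∀ x y → x *ʳ y ≈ʳ y *ʳ x
    *ʳ-comm x y = pointwise λ n → *-comm (seq x n) (seq y n)

    *ʳ-identityˡ : ∀ x → 1ʳ *ʳ x ≈ʳ x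
    *ʳ-identityˡ x = pointwise λ n → *-identityˡ (seq x n)

    *ʳ-distribʳ : ∀ x y z → (y +ʳ z) *ʳ x ≈ʳ y *ʳ x +ʳ z *ʳ x
    *ʳ-distribʳ x y z = pointwise λ n → *-distribʳ-+ (seq x n) (seq y n) (seq z n)

    *ʳ-distribˡ : ∀ x y z → x *ʳ (y +ʳ z) ≈ʳ x *ʳ y +ʳ x *ʳ z
    *ʳ-distribˡ x y z = pointwise λ n → *-distribˡ-+ (seq x n) (seq y n) (seq z n)

    isCommutativeRing : IsCommutativeRing _≈ʳ_ _+ʳ_ _*ʳ_ -ʳ_ 0ʳ 1ʳ
    isCommutativeRing = record
      { isRing = record
        { +-isAbelianGroup = record
          { isGroup = record
            { isMonoid = record
              { isSemigroup = record
                { isMagma = record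
                  { isEquivalence = record { refl = ≈-refl ; sym = ≈-sym ; trans = ≈-trans }
                  ; ∙-cong = +-cong
                  }
                ; assoc = +ʳ-assoc
                }
              ; identity = +ʳ-identityˡ , λ x → ≈-trans (+ʳ-comm x 0ʳ) (+ʳ-identityˡ x)
              }
            ; inverse = +ʳ-inverseˡ , λ x → ≈-trans (+ʳ-comm x (-ʳ x)) (+ʳ-inverseˡ x)
            ; ⁻¹-cong = neg-cong
            }
          ; comm = +ʳ-comm
          }
        ; *-cong = *-cong
        ; *-assoc = *ʳ-assoc
        ; *-identity = *ʳ-identityˡ , λ x → ≈-trans (*ʳ-comm x 1ʳ) (*ʳ-identityˡ x)
        ; distrib = *ʳ-distribˡ , *ʳ-distribʳ
        }
      ; *-comm = *ʳ-comm
      }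

    #-irrefl : ∀ {x y} → x ≈ʳ y → ¬ x #ʳ y
    #-irrefl x≈y (mk# 0<ε {M} h) with null x≈y 0<ε
    ... | N , k = <-irrefl refl (<-trans (h (ℕ.m≤m⊔n M N)) (k (ℕ.m≤n⊔m M N) (ℕ.m≤n⊔m M N)))

    #-sym : ∀ {x y} → x #ʳ y → y #ʳ x
    #-sym {x} {y} (mk# {ε} 0<ε h) = mk# 0<ε
      λ {n} p → subst (ε <_) (∣-∣-sym (seq x n) (seq y n)) (h p)

    Within : ℚ → ℕ → ℝ → Set
    Within δ N x = ∀ {n} → N ℕ.≤ n → ∣ seq x N - seq x n ∣ < δ

    within : ∀ x {δ} → 0ℚ < δ → ∃[ M ] (∀ {N} → M ℕ.≤ N → Within δ N x)
    within x 0<δ with cauchy x 0<δ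
    ... | M , h = M , λ M≤N N≤n → h M≤N (ℕ.≤-trans M≤N N≤n)

    apart-at : ∀ {x y δ η N} → 0ℚ < δ → (δ + δ) + (δ + δ) ≡ η →
               Within δ N x → Within δ N y → η < ∣ seq x N - seq y N ∣ → x #ʳ y
    apart-at {x} {y} {δ} {η} {N} 0<δ 4δ≡η wx wy far = mk# (+-mono-< 0<δ 0<δ) {N} λ {n} N≤n → +-cancelʳ-< (δ + δ) (begin-strict
        (δ + δ) + (δ + δ) ≡⟨ 4δ≡η ⟩
        η <⟨ far ⟩
        ∣ seq x N - seq y N ∣ ≤⟨ triangle (seq x N) (seq x n) (seq y N) ⟩
        ∣ seq x N - seq x n ∣ + ∣ seq x n - seq y N ∣
          ≤⟨ +-monoʳ-≤ ∣ seq x N - seq x n ∣ (triangle (seq x n) (seq y n) (seq y N)) ⟩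
        ∣ seq x N - seq x n ∣ + (∣ seq x n - seq y n ∣ + ∣ seq y n - seq y N ∣)
          ≡⟨ cong (λ t → ∣ seq x N - seq x n ∣ + (∣ seq x n - seq y n ∣ + t))
                  (∣-∣-sym (seq y n) (seq y N)) ⟩
        ∣ seq x N - seq x n ∣ + (∣ seq x n - seq y n ∣ + ∣ seq y N - seq y n ∣)
          <⟨ +-mono-< (wx N≤n) (+-monoʳ-< ∣ seq x n - seq y n ∣ (wy N≤n)) ⟩
        δ + (∣ seq x n - seq y n ∣ + δ)
          ≡⟨ solve 2 (λ d a → d :+ (a :+ d) := a :+ (d :+ d)) refl δ ∣ seq x n - seq y n ∣ ⟩
        ∣ seq x n - seq y n ∣ + (δ + δ) ∎)

    abstract
      eighth : ∀ {ε} → 0ℚ < ε → ∃[ δ ] ∃[ η ] (0ℚ < δ × (δ + δ) + (δ + δ) ≡ η × η + η ≡ ε)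
      eighth {ε} 0<ε = ⅛ * ε , ½ * ε , 0<* 0<⅛ 0<ε
        , solve 1 (λ ε → let d = con ⅛ :* ε in (d :+ d) :+ (d :+ d) := con ½ :* ε) refl ε
        , solve 1 (λ ε → con ½ :* ε :+ con ½ :* ε := ε) refl ε

    upper-bound : ∀ K L M N → let P = K ℕ.⊔ (L ℕ.⊔ (M ℕ.⊔ N)) in
                  K ℕ.≤ P × L ℕ.≤ P × M ℕ.≤ P × N ℕ.≤ P
    upper-bound K L M N = ⊔ˡ P≤P , ⊔ˡ (⊔ʳ {K} P≤P) , ⊔ˡ (⊔ʳ {L} (⊔ʳ {K} P≤P)) , ⊔ʳ {M} (⊔ʳ {L} (⊔ʳ {K} P≤P))
      where P≤P = ℕ.≤-refl {K ℕ.⊔ (L ℕ.⊔ (M ℕ.⊔ N))}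

    cotrans-at : ∀ {x y z δ η ε N} → 0ℚ < δ → (δ + δ) + (δ + δ) ≡ η → η + η ≡ ε →
                 Within δ N x → Within δ N y → Within δ N z → ε < ∣ seq x N - seq y N ∣ →
                 Dec (η < ∣ seq x N - seq z N ∣) → x #ʳ z ⊎ z #ʳ y
    cotrans-at 0<δ 4δ≡η 2η≡ε wx wy wz h (yes far) = inj₁ (apart-at 0<δ 4δ≡η wx wz far)
    cotrans-at {x} {y} {z} {δ} {η} {ε} {N} 0<δ 4δ≡η 2η≡ε wx wy wz h (no ¬far) =
      inj₂ (apart-at 0<δ 4δ≡η wz wy (+-cancelʳ-< η (begin-strict
        η + η                  ≡⟨ 2η≡ε ⟩
        ε                      <⟨ h ⟩
        ∣ seq x N - seq y N ∣  ≤⟨ triangle (seq x N) (seq z N) (seq y N) ⟩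
        ∣ seq x N - seq z N ∣ + ∣ seq z N - seq y N ∣
          ≤⟨ +-monoˡ-≤ ∣ seq z N - seq y N ∣ (≮⇒≥ ¬far) ⟩
        η + ∣ seq z N - seq y N ∣  ≡⟨ +-comm η ∣ seq z N - seq y N ∣ ⟩
        ∣ seq z N - seq y N ∣ + η  ∎)))

    #-cotrans : ∀ {x y} → x #ʳ y → ∀ z → x #ʳ z ⊎ z #ʳ y
    #-cotrans {x} {y} (mk# 0<ε {K} h) z =
      let δ , η , 0<δ , 4δ≡η , 2η≡ε = eighth 0<ε
          L , wx = within x 0<δ
          M , wy = within y 0<δ
          N , wz = within z 0<δ
          K≤P , L≤P , M≤P , N≤P = upper-bound K L M N
      in cotrans-at 0<δ 4δ≡η 2η≡ε (wx L≤P) (wy M≤P) (wz N≤P) (h K≤P) (η <? _)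

    near-at : ∀ {x y δ η ε N} → 0ℚ < δ → (δ + δ) + (δ + δ) ≡ η → η + η ≡ ε →
              Within δ N x → Within δ N y → ∣ seq x N - seq y N ∣ ≤ η →
              ∀ {m n} → N ℕ.≤ m → N ℕ.≤ n → ∣ seq x m - seq y n ∣ < ε
    near-at {x} {y} {δ} {η} {ε} {N} 0<δ 4δ≡η 2η≡ε wx wy near {m} {n} N≤m N≤n = begin-strict
      ∣ seq x m - seq y n ∣  ≤⟨ triangle (seq x m) (seq x N) (seq y n) ⟩
      ∣ seq x m - seq x N ∣ + ∣ seq x N - seq y n ∣
        ≤⟨ +-monoʳ-≤ ∣ seq x m - seq x N ∣ (triangle (seq x N) (seq y N) (seq y n)) ⟩
      ∣ seq x m - seq x N ∣ + (∣ seq x N - seq y N ∣ + ∣ seq y N - seq y n ∣)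
        ≡⟨ cong (_+ (∣ seq x N - seq y N ∣ + ∣ seq y N - seq y n ∣)) (∣-∣-sym (seq x m) (seq x N)) ⟩
      ∣ seq x N - seq x m ∣ + (∣ seq x N - seq y N ∣ + ∣ seq y N - seq y n ∣)
        <⟨ +-mono-<-≤ (wx N≤m) (+-mono-≤ near (<⇒≤ (wy N≤n))) ⟩
      δ + (η + δ)            ≡⟨ +-identityʳ (δ + (η + δ)) ⟨
      δ + (η + δ) + 0ℚ       ≤⟨ +-monoʳ-≤ (δ + (η + δ)) (<⇒≤ (+-mono-< 0<δ 0<δ)) ⟩
      δ + (η + δ) + (δ + δ)
        ≡⟨ solve 2 (λ d η → d :+ (η :+ d) :+ (d :+ d) := η :+ ((d :+ d) :+ (d :+ d))) refl δ η ⟩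
      η + ((δ + δ) + (δ + δ))  ≡⟨ cong (λ t → η + t) 4δ≡η ⟩
      η + η                  ≡⟨ 2η≡ε ⟩
      ε                      ∎

    #-tight : ∀ {x y} → ¬ x #ʳ y → x ≈ʳ y
    #-tight {x} {y} ¬x#y .null {ε} 0<ε with eighth 0<ε
    ... | δ , η , 0<δ , 4δ≡η , 2η≡ε with within x 0<δ | within y 0<δ
    ... | M , wx | N , wy = M ℕ.⊔ N , near-at {x} {y} 0<δ 4δ≡η 2η≡ε wx′ wy′
      (≮⇒≥ (λ far → ¬x#y (apart-at 0<δ 4δ≡η wx′ wy′ far)))
      where
      wx′ : Within δ (M ℕ.⊔ N) x
      wx′ = wx (ℕ.m≤m⊔n M N)
      wy′ : Within δ (M ℕ.⊔ N) y
      wy′ = wy (ℕ.m≤n⊔m M N)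

    inverse : ∀ {x y} → x #ʳ y → ∃[ z ] z *ʳ (x +ʳ -ʳ y) ≈ʳ 1ʳ
    inverse {x} {y} (mk# {ε} 0<ε {N} h) = r̂ , mk≈ (null-ext N
      (λ {m} p _ → sym (trans (cong (λ t → t - 1ℚ) (recip-* (d m) (d≢0 p))) (+-inverseʳ 1ℚ))) null-0)
      where
      d r : ℕ → ℚ
      d n = seq (x +ʳ -ʳ y) n
      r n = recip (d n)

      d≢0 : ∀ {n} → N ℕ.≤ n → d n ≢ 0ℚ
      d≢0 p = <∣p∣⇒≢0 0<ε (h p)

      r-bounded : Bounded (λ m _ → r m)
      r-bounded = recip ε , 0<recip 0<ε , N , λ {m} p _ →
        *-cancelʳ-<-nonNeg ε {{nonNegative (<⇒≤ 0<ε)}} (begin-strict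
          ∣ r m ∣ * ε        <⟨ *-monoʳ-<-pos ∣ r m ∣ {{positive (0<∣r∣ p)}} (h p) ⟩
          ∣ r m ∣ * ∣ d m ∣  ≡⟨ ∣p*q∣≡∣p∣*∣q∣ (r m) (d m) ⟨
          ∣ r m * d m ∣      ≡⟨ cong ∣_∣ (recip-* (d m) (d≢0 p)) ⟩
          1ℚ                 ≡⟨ recip-* ε (λ { refl → <-irrefl refl 0<ε }) ⟨
          recip ε * ε        ∎)
        where
        0<∣r∣ : ∀ {m} → N ℕ.≤ m → 0ℚ < ∣ r m ∣
        0<∣r∣ {m} p with 0ℚ <? ∣ r m ∣
        ... | yes 0<r = 0<r
        ... | no ¬0<r = contradiction
          (trans (sym (recip-* (d m) (d≢0 p)))
            (trans (cong (_* d m) (∣p∣≡0⇒p≡0 (r m) (≤-antisym (≮⇒≥ ¬0<r) (0≤∣p∣ (r m)))))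
                   (*-zeroˡ (d m))))
          (λ ())

      r̂ : ℝ
      r̂ .seq    = r
      r̂ .cauchy = null-ext N
        (λ {m} {n} p q →
          trans (solve 4 (λ a b u v → (u :* v) :* (b :- a) := u :* (v :* b) :- v :* (u :* a)) refl
                   (d m) (d n) (r m) (r n))
          (trans (cong₂ (λ s t → r m * s - r n * t) (recip-* (d n) (d≢0 q)) (recip-* (d m) (d≢0 p)))
          (cong₂ _-_ (*-identityʳ (r m)) (*-identityʳ (r n)))))
        (null-* (bounded-* r-bounded (bounded-swap r-bounded)) (null-swap (cauchy (x +ʳ -ʳ y))))

    away-from-0 : ∀ {B h u d} → 0ℚ < B → h + h ≡ 1ℚ → ∣ u ∣ < B → ∣ u * d - 1ℚ ∣ < h →
                  recip B * h < ∣ d ∣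
    away-from-0 {B} {h} {u} {d} 0<B 2h≡1 u<B ud~1 = *-cancelˡ-<-nonNeg B {{nonNegative (<⇒≤ 0<B)}}
      (begin-strict
        B * (recip B * h)  ≡⟨ solve 3 (λ B r ε → B :* (r :* ε) := (r :* B) :* ε) refl B (recip B) h ⟩
        recip B * B * h    ≡⟨ cong (_* h) (recip-* B (λ { refl → <-irrefl refl 0<B })) ⟩
        1ℚ * h             ≡⟨ *-identityˡ h ⟩
        h                  <⟨ h<∣ud∣ ⟩
        ∣ u * d ∣          ≡⟨ ∣p*q∣≡∣p∣*∣q∣ u d ⟩
        ∣ u ∣ * ∣ d ∣      ≤⟨ *-monoʳ-≤-nonNeg ∣ d ∣ {{∣-∣-nonNeg d}} (<⇒≤ u<B) ⟩
        B * ∣ d ∣          ∎)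
      where
      h<∣ud∣ : h < ∣ u * d ∣
      h<∣ud∣ = +-cancelʳ-< h (begin-strict
        h + h                            ≡⟨ 2h≡1 ⟩
        ∣ 1ℚ ∣                           ≡⟨ cong ∣_∣ (solve 1 (λ p → con 1ℚ := p :+ (con 1ℚ :- p)) refl (u * d)) ⟩
        ∣ u * d + (1ℚ - u * d) ∣         ≤⟨ ∣p+q∣≤∣p∣+∣q∣ (u * d) (1ℚ - u * d) ⟩
        ∣ u * d ∣ + ∣ 1ℚ - u * d ∣       ≡⟨ cong (λ t → ∣ u * d ∣ + t) (∣-∣-sym 1ℚ (u * d)) ⟩
        ∣ u * d ∣ + ∣ u * d - 1ℚ ∣       <⟨ +-monoʳ-< ∣ u * d ∣ ud~1 ⟩
        ∣ u * d ∣ + h                    ∎)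

    inverse⇒# : ∀ {x y z} → z *ʳ (x +ʳ -ʳ y) ≈ʳ 1ʳ → x #ʳ y
    inverse⇒# {x} {y} {z} zd≈1 =
      let B , 0<B , M , h = bdd z
          N , k = null zd≈1 0<½
      in mk# (0<* (0<recip 0<B) 0<½) {M ℕ.⊔ N} λ p →
           away-from-0 0<B refl (h (⊔ˡ {M} p) (⊔ˡ {M} p)) (k (⊔ʳ {M} p) (⊔ʳ {M} p))

  open ℝ-Properties

  ℝ-heytingField : HeytingField 0ℓ 0ℓ 0ℓ
  ℝ-heytingField = record
    { Carrier = ℝ ; _≈_ = _≈ʳ_ ; _#_ = _#ʳ_ ; _+_ = _+ʳ_ ; _*_ = _*ʳ_ ; -_ = -ʳ_ ; 0# = 0ʳ ; 1# = 1ʳ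
    ; isHeytingField = record
      { isHeytingCommutativeRing = record
        { isCommutativeRing = isCommutativeRing
        ; isApartnessRelation = record { irrefl = #-irrefl ; sym = #-sym ; cotrans = #-cotrans }
        ; #⇒invertible = λ {x} {y} x#y → let z , zd≈1 = inverse x#y in
            z , zd≈1 , ≈-trans (*ʳ-comm (x +ʳ -ʳ y) z) zd≈1
        ; invertible⇒# = λ (_ , zd≈1 , _) → inverse⇒# zd≈1
        }
      ; tight = λ _ _ → #-tight , #-irrefl
      }
    }

  module ℝF = HeytingField ℝ-heytingField
  module ℝP = HeytingCommutativeRingProperties ℝF.heytingCommutativeRing

  record ℂ : Set where
    no-eta-equality
    field re im : ℝ

  open ℂ

  infix 4 _≈ᶜ_ _#ᶜ_

  record _≈ᶜ_ (z w : ℂ) : Set where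
    no-eta-equality
    constructor _,ᶜ_
    field
      re≈ : re z ≈ʳ re w
      im≈ : im z ≈ʳ im w

  open _≈ᶜ_

  data _#ᶜ_ (z w : ℂ) : Set where
    re# : re z #ʳ re w → z #ᶜ w
    im# : im z #ʳ im w → z #ᶜ w

  infixl 6 _+ᶜ_
  infixl 7 _*ᶜ_
  infix  8 -ᶜ_

  _+ᶜ_ : ℂ → ℂ → ℂ
  (z +ᶜ w) .re = re z +ʳ re w
  (z +ᶜ w) .im = im z +ʳ im w

  _*ᶜ_ : ℂ → ℂ → ℂ
  (z *ᶜ w) .re = re z *ʳ re w +ʳ -ʳ (im z *ʳ im w)
  (z *ᶜ w) .im = re z *ʳ im w +ʳ im z *ʳ re w

  -ᶜ_ : ℂ → ℂ
  (-ᶜ z) .re = -ʳ re z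
  (-ᶜ z) .im = -ʳ im z

  fromℝ : ℝ → ℂ
  fromℝ x .re = x
  fromℝ x .im = 0ʳ

  0ᶜ 1ᶜ : ℂ
  0ᶜ = fromℝ 0ʳ
  1ᶜ = fromℝ 1ʳ

  module ℂ-Properties where
    open +-*-Solver

    *ᶜ-comm : ∀ z w → z *ᶜ w ≈ᶜ w *ᶜ z
    *ᶜ-comm z w =
      (pointwise λ n → solve 4 (λ a b c d → a :* c :- b :* d := c :* a :- d :* b) refl
        (seq (re z) n) (seq (im z) n) (seq (re w) n) (seq (im w) n)) ,ᶜ
      (pointwise λ n → solve 4 (λ a b c d → a :* d :+ b :* c := c :* b :+ d :* a) refl
        (seq (re z) n) (seq (im z) n) (seq (re w) n) (seq (im w) n))

    *ᶜ-assoc : ∀ z w v → (z *ᶜ w) *ᶜ v ≈ᶜ z *ᶜ (w *ᶜ v)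
    *ᶜ-assoc z w v =
      (pointwise λ n → solve 6 (λ a b c d e f →
          (a :* c :- b :* d) :* e :- (a :* d :+ b :* c) :* f
          := a :* (c :* e :- d :* f) :- b :* (c :* f :+ d :* e)) refl
        (seq (re z) n) (seq (im z) n) (seq (re w) n) (seq (im w) n) (seq (re v) n) (seq (im v) n)) ,ᶜ
      (pointwise λ n → solve 6 (λ a b c d e f →
          (a :* c :- b :* d) :* f :+ (a :* d :+ b :* c) :* e
          := a :* (c :* f :+ d :* e) :+ b :* (c :* e :- d :* f)) refl
        (seq (re z) n) (seq (im z) n) (seq (re w) n) (seq (im w) n) (seq (re v) n) (seq (im v) n))

    *ᶜ-identityˡ : ∀ z → 1ᶜ *ᶜ z ≈ᶜ z
    *ᶜ-identityˡ z =
      (pointwise λ n → solve 2 (λ a b → con 1ℚ :* a :- con 0ℚ :* b := a) refl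
        (seq (re z) n) (seq (im z) n)) ,ᶜ
      (pointwise λ n → solve 2 (λ a b → con 1ℚ :* b :+ con 0ℚ :* a := b) refl
        (seq (re z) n) (seq (im z) n))

    *ᶜ-distribʳ : ∀ v z w → (z +ᶜ w) *ᶜ v ≈ᶜ z *ᶜ v +ᶜ w *ᶜ v
    *ᶜ-distribʳ v z w =
      (pointwise λ n → solve 6 (λ a b c d e f →
          (a :+ c) :* e :- (b :+ d) :* f := (a :* e :- b :* f) :+ (c :* e :- d :* f)) refl
        (seq (re z) n) (seq (im z) n) (seq (re w) n) (seq (im w) n) (seq (re v) n) (seq (im v) n)) ,ᶜ
      (pointwise λ n → solve 6 (λ a b c d e f →
          (a :+ c) :* f :+ (b :+ d) :* e := (a :* f :+ b :* e) :+ (c :* f :+ d :* e)) refl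
        (seq (re z) n) (seq (im z) n) (seq (re w) n) (seq (im w) n) (seq (re v) n) (seq (im v) n))

    ≈ᶜ-trans : ∀ {z w v} → z ≈ᶜ w → w ≈ᶜ v → z ≈ᶜ v
    ≈ᶜ-trans p q = ≈-trans (re≈ p) (re≈ q) ,ᶜ ≈-trans (im≈ p) (im≈ q)

    +ᶜ-cong : ∀ {z z′ w w′} → z ≈ᶜ z′ → w ≈ᶜ w′ → z +ᶜ w ≈ᶜ z′ +ᶜ w′
    +ᶜ-cong p q = +-cong (re≈ p) (re≈ q) ,ᶜ +-cong (im≈ p) (im≈ q)

    *ᶜ-cong : ∀ {z z′ w w′} → z ≈ᶜ z′ → w ≈ᶜ w′ → z *ᶜ w ≈ᶜ z′ *ᶜ w′
    *ᶜ-cong p q =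
      +-cong (*-cong (re≈ p) (re≈ q)) (neg-cong (*-cong (im≈ p) (im≈ q))) ,ᶜ
      +-cong (*-cong (re≈ p) (im≈ q)) (*-cong (im≈ p) (re≈ q))

    *ᶜ-distribˡ : ∀ v z w → v *ᶜ (z +ᶜ w) ≈ᶜ v *ᶜ z +ᶜ v *ᶜ w
    *ᶜ-distribˡ v z w = ≈ᶜ-trans (*ᶜ-comm v (z +ᶜ w))
      (≈ᶜ-trans (*ᶜ-distribʳ v z w) (+ᶜ-cong (*ᶜ-comm z v) (*ᶜ-comm w v)))

    ℂ-isCommutativeRing : IsCommutativeRing _≈ᶜ_ _+ᶜ_ _*ᶜ_ -ᶜ_ 0ᶜ 1ᶜ
    ℂ-isCommutativeRing = record
      { isRing = record
        { +-isAbelianGroup = record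
          { isGroup = record
            { isMonoid = record
              { isSemigroup = record
                { isMagma = record
                  { isEquivalence = record
                    { refl  = ≈-refl ,ᶜ ≈-refl
                    ; sym   = λ p → ≈-sym (re≈ p) ,ᶜ ≈-sym (im≈ p)
                    ; trans = ≈ᶜ-trans
                    }
                  ; ∙-cong = +ᶜ-cong
                  }
                ; assoc = λ z w v → ℝF.+-assoc _ _ _ ,ᶜ ℝF.+-assoc _ _ _
                }
              ; identity = (λ z → ℝF.+-identityˡ _ ,ᶜ ℝF.+-identityˡ _)
                         , (λ z → ℝF.+-identityʳ _ ,ᶜ ℝF.+-identityʳ _)
              }
            ; inverse = (λ z → ℝF.-‿inverseˡ _ ,ᶜ ℝF.-‿inverseˡ _)
                      , (λ z → ℝF.-‿inverseʳ _ ,ᶜ ℝF.-‿inverseʳ _)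
            ; ⁻¹-cong = λ p → neg-cong (re≈ p) ,ᶜ neg-cong (im≈ p)
            }
          ; comm = λ z w → ℝF.+-comm _ _ ,ᶜ ℝF.+-comm _ _
          }
        ; *-cong = *ᶜ-cong
        ; *-assoc = *ᶜ-assoc
        ; *-identity = *ᶜ-identityˡ , λ z → ≈ᶜ-trans (*ᶜ-comm z 1ᶜ) (*ᶜ-identityˡ z)
        ; distrib = *ᶜ-distribˡ , *ᶜ-distribʳ
        }
      ; *-comm = *ᶜ-comm
      }

    #ᶜ-cotrans : ∀ {z w} → z #ᶜ w → ∀ v → z #ᶜ v ⊎ v #ᶜ w
    #ᶜ-cotrans (re# h) v = Sum.map re# re# (#-cotrans h (re v))
    #ᶜ-cotrans (im# h) v = Sum.map im# im# (#-cotrans h (im v))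

    #ᶜ-irrefl : ∀ {z w} → z ≈ᶜ w → ¬ z #ᶜ w
    #ᶜ-irrefl p (re# h) = #-irrefl (re≈ p) h
    #ᶜ-irrefl p (im# h) = #-irrefl (im≈ p) h

    #ᶜ-sym : ∀ {z w} → z #ᶜ w → w #ᶜ z
    #ᶜ-sym (re# h) = re# (#-sym h)
    #ᶜ-sym (im# h) = im# (#-sym h)

    *-#0ˡ : ∀ {x y} → x *ʳ y #ʳ 0ʳ → x #ʳ 0ʳ
    *-#0ˡ {x} {y} h =
      let u , u[xy]≈1 = inverse h
      in inverse⇒# {x} {0ʳ} {u *ʳ y} (≈-trans
           (pointwise λ n → solve 3 (λ u x y → (u :* y) :* (x :- con 0ℚ) := u :* (x :* y :- con 0ℚ)) refl
             (seq u n) (seq x n) (seq y n))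
           u[xy]≈1)

    -‿#0⇒# : ∀ {x y} → x +ʳ -ʳ y #ʳ 0ʳ → x #ʳ y
    -‿#0⇒# {x} {y} h =
      let u , u[x-y]≈1 = inverse h
      in inverse⇒# {x} {y} {u} (≈-trans
           (pointwise λ n → solve 3 (λ u x y → u :* (x :- y) := u :* ((x :- y) :- con 0ℚ)) refl
             (seq u n) (seq x n) (seq y n))
           u[x-y]≈1)

    #⇒-‿#0 : ∀ {x y} → x #ʳ y → x +ʳ -ʳ y #ʳ 0ʳ
    #⇒-‿#0 {x} {y} h =
      let u , u[x-y]≈1 = inverse h
      in inverse⇒# {x +ʳ -ʳ y} {0ʳ} {u} (≈-trans
           (pointwise λ n → solve 3 (λ u x y → u :* ((x :- y) :- con 0ℚ) := u :* (x :- y)) refl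
             (seq u n) (seq x n) (seq y n))
           u[x-y]≈1)

    +-#0 : ∀ {x y} → x +ʳ y #ʳ 0ʳ → x #ʳ 0ʳ ⊎ y #ʳ 0ʳ
    +-#0 {x} {y} h with #-cotrans h y
    ... | inj₂ y#0   = inj₂ y#0
    ... | inj₁ x+y#y = inj₁ (ℝP.#-congʳ
      (pointwise λ n → solve 2 (λ x y → (x :+ y) :- y := x) refl (seq x n) (seq y n))
      (#⇒-‿#0 x+y#y))

    ∣_∣² : ℂ → ℝ
    ∣ z ∣² = re z *ʳ re z +ʳ im z *ʳ im z

    0≤² : ∀ p → 0ℚ ≤ p * p
    0≤² p = subst (0ℚ ≤_) (∣p∣*∣p∣ p) (subst (_≤ ∣ p ∣ * ∣ p ∣) (*-zeroˡ ∣ p ∣)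
      (*-monoʳ-≤-nonNeg ∣ p ∣ {{∣-∣-nonNeg p}} (0≤∣p∣ p)))
      where
      ∣p∣*∣p∣ : ∀ p → ∣ p ∣ * ∣ p ∣ ≡ p * p
      ∣p∣*∣p∣ p with ∣p∣≡p∨∣p∣≡-p p
      ... | inj₁ e = cong₂ _*_ e e
      ... | inj₂ e = trans (cong₂ _*_ e e)
        (solve 1 (λ p → (:- p) :* (:- p) := p :* p) refl p)

    ²+²#0 : ∀ {x} y → x #ʳ 0ʳ → x *ʳ x +ʳ y *ʳ y #ʳ 0ʳ
    ²+²#0 {x} y (mk# {ε} 0<ε {N} h) = mk# (0<* 0<ε 0<ε) {N} λ {n} p → begin-strict
        ε * ε
          <⟨ *-mono-<-nonNeg (<⇒≤ 0<ε) (<⇒≤ 0<ε) (h p) (h p) ⟩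
        ∣ seq x n - 0ℚ ∣ * ∣ seq x n - 0ℚ ∣
          ≡⟨ ∣p*q∣≡∣p∣*∣q∣ (seq x n - 0ℚ) (seq x n - 0ℚ) ⟨
        ∣ (seq x n - 0ℚ) * (seq x n - 0ℚ) ∣
          ≡⟨ cong ∣_∣ (solve 1 (λ a → (a :- con 0ℚ) :* (a :- con 0ℚ) := a :* a) refl (seq x n)) ⟩
        ∣ seq x n * seq x n ∣
          ≡⟨ 0≤p⇒∣p∣≡p (0≤² (seq x n)) ⟩
        seq x n * seq x n
          ≡⟨ +-identityʳ (seq x n * seq x n) ⟨
        seq x n * seq x n + 0ℚ
          ≤⟨ +-monoʳ-≤ (seq x n * seq x n) (0≤² (seq y n)) ⟩
        seq x n * seq x n + seq y n * seq y n
          ≤⟨ p≤∣p∣ (seq x n * seq x n + seq y n * seq y n) ⟩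
        ∣ seq x n * seq x n + seq y n * seq y n ∣
          ≡⟨ cong ∣_∣ (solve 1 (λ a → a := a :- con 0ℚ) refl (seq x n * seq x n + seq y n * seq y n)) ⟩
        ∣ (seq x n * seq x n + seq y n * seq y n) - 0ℚ ∣ ∎
      where
      open ≤-Reasoning
      p≤∣p∣ : ∀ p → p ≤ ∣ p ∣
      p≤∣p∣ p with 0ℚ ≤? p
      ... | yes 0≤p = ≤-reflexive (sym (0≤p⇒∣p∣≡p 0≤p))
      ... | no ¬0≤p = ≤-trans (<⇒≤ (≰⇒> ¬0≤p)) (0≤∣p∣ p)

    ∣∣²#0 : ∀ {z} → z #ᶜ 0ᶜ → ∣ z ∣² #ʳ 0ʳ
    ∣∣²#0 {z} (re# h) = ²+²#0 (im z) h
    ∣∣²#0 {z} (im# h) = ℝP.#-congʳ (ℝF.+-comm _ _) (²+²#0 (re z) h)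

    -- z̄ / ∣z∣²
    inverseᶜ : ∀ {z} → z #ᶜ 0ᶜ → ∃[ w ] w *ᶜ z ≈ᶜ 1ᶜ
    inverseᶜ {z} z#0 = w ,
      (≈-trans
        (pointwise λ n → solve 3 (λ a b r →
            (r :* a) :* a :- (:- (r :* b)) :* b := r :* ((a :* a :+ b :* b) :- con 0ℚ)) refl
          (seq (re z) n) (seq (im z) n) (seq r n))
        (proj₂ (inverse (∣∣²#0 z#0))) ,ᶜ
      pointwise λ n → solve 3 (λ a b r →
            (r :* a) :* b :+ (:- (r :* b)) :* a := con 0ℚ) refl
          (seq (re z) n) (seq (im z) n) (seq r n))
      where
      r : ℝ
      r = proj₁ (inverse (∣∣²#0 z#0))
      w : ℂ
      w .re = r *ʳ re z
      w .im = -ʳ (r *ʳ im z)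

    invertible⇒#0 : ∀ {z w} → w *ᶜ z ≈ᶜ 1ᶜ → z #ᶜ 0ᶜ
    invertible⇒#0 {z} {w} wz≈1 = Sum.[ real , imaginary ] (+-#0 (ℝP.#-congʳ (≈-sym (re≈ wz≈1)) ℝP.1#0))
      where
      real : re w *ʳ re z #ʳ 0ʳ → z #ᶜ 0ᶜ
      real h = re# (*-#0ˡ (ℝP.#-congʳ (*ʳ-comm (re w) (re z)) h))

      imaginary : -ʳ (im w *ʳ im z) #ʳ 0ʳ → z #ᶜ 0ᶜ
      imaginary h = im# (*-#0ˡ {im z} { -ʳ im w} (ℝP.#-congʳ
        (pointwise λ n → solve 2 (λ c b → :- (c :* b) := b :* :- c) refl (seq (im w) n) (seq (im z) n)) h))

    -‿#0⇒#ᶜ : ∀ {z w} → z +ᶜ -ᶜ w #ᶜ 0ᶜ → z #ᶜ w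
    -‿#0⇒#ᶜ (re# h) = re# (-‿#0⇒# h)
    -‿#0⇒#ᶜ (im# h) = im# (-‿#0⇒# h)

    #⇒-‿#0ᶜ : ∀ {z w} → z #ᶜ w → z +ᶜ -ᶜ w #ᶜ 0ᶜ
    #⇒-‿#0ᶜ (re# h) = re# (#⇒-‿#0 h)
    #⇒-‿#0ᶜ (im# h) = im# (#⇒-‿#0 h)

  open ℂ-Properties

  ℂ-heytingField : HeytingField 0ℓ 0ℓ 0ℓ
  ℂ-heytingField = record
    { Carrier = ℂ ; _≈_ = _≈ᶜ_ ; _#_ = _#ᶜ_ ; _+_ = _+ᶜ_ ; _*_ = _*ᶜ_ ; -_ = -ᶜ_ ; 0# = 0ᶜ ; 1# = 1ᶜ
    ; isHeytingField = record
      { isHeytingCommutativeRing = record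
        { isCommutativeRing = ℂ-isCommutativeRing
        ; isApartnessRelation = record
          { irrefl = #ᶜ-irrefl ; sym = #ᶜ-sym ; cotrans = #ᶜ-cotrans }
        ; #⇒invertible = λ {z} {w} z#w → let v , v*≈1 = inverseᶜ (#⇒-‿#0ᶜ z#w) in
            v , v*≈1 , ≈ᶜ-trans (*ᶜ-comm (z +ᶜ -ᶜ w) v) v*≈1
        ; invertible⇒# = λ (_ , v*≈1 , _) → -‿#0⇒#ᶜ (invertible⇒#0 v*≈1)
        }
      ; tight = λ _ _ →
          (λ ¬z#w → #-tight (¬z#w ∘ re#) ,ᶜ #-tight (¬z#w ∘ im#)) , #ᶜ-irrefl
      }
    }

-- λ being a keyword, the base of the calculus is written q.
module λ-Calculus {c ℓ₁ ℓ₂} (K : HeytingField c ℓ₁ ℓ₂) where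

  open HeytingField K hiding (zero; refl; sym) renaming (trans to ≈-trans)
  open import Data.Nat.Base using (_≤_; _∸_)
  open HeytingCommutativeRingProperties heytingCommutativeRing
    using (x#0y#0→xy#0; 1#0; x-0≈x; invertibleˡ⇒#; #-congʳ)
  open CommutativeRing (HeytingCommutativeRing.commutativeRing heytingCommutativeRing)
    using (semiring)
  open import Algebra.Definitions.RawSemiring (Semiring.rawSemiring semiring) public using (_^_; product)
  open import Algebra.Properties.Semiring.Sum semiring public
    using (sum; sum-syntax; sum⁺-syntax)

  product-syntax : ∀ n → Vector Carrier n → Carrier
  product-syntax _ = product

  infixl 10 product-syntax
  syntax product-syntax n (λ i → x) = ∏[ i < n ] x

  K^× : Set (c ⊔ ℓ₂)
  K^× = Σ Carrier (_# 0#)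

  val : K^× → Carrier
  val = proj₁

  infix  9 _⁻¹
  infixl 7 _/_ _·_ _÷_
  infixr 8 _^×_

  -- #⇒invertible inverts x - 0#, which is ≈ to x but not the same term
  _⁻¹ : K^× → Carrier
  (x , x#0) ⁻¹ = proj₁ (#⇒invertible x#0)

  _/_ : Carrier → K^× → Carrier
  x / y = x * y ⁻¹

  ⁻¹#0 : ∀ x → x ⁻¹ # 0#
  ⁻¹#0 (x , x#0) = let y , _ , [x-0]*y≈1 = #⇒invertible x#0 in
    invertibleˡ⇒# (x - 0# , ≈-trans (*-congˡ (x-0≈x y)) [x-0]*y≈1)

  _·_ : K^× → K^× → K^×
  (x , x#0) · (y , y#0) = x * y , x#0y#0→xy#0 x#0 y#0

  _÷_ : K^× → K^× → K^×
  x ÷ y = val x / y , x#0y#0→xy#0 (proj₂ x) (⁻¹#0 y)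

  _^×_ : K^× → ℕ → K^×
  x ^× zero  = 1# , 1#0
  x ^× suc n = x · x ^× n

  -- (x - a)_q^k, a function of x and a rather than a power of x - a
  ⟨_-_⟩[_]^_ : K^× → Carrier → K^× → ℕ → Carrier
  ⟨ x - a ⟩[ q ]^ k = ∏[ j < k ] (1# - a / (q ^× toℕ j · x))

  -- (q ; q)ₘ
  ⟨_⁏_⟩ : Carrier → ℕ → Carrier
  ⟨ q ⁏ m ⟩ = ∏[ j < m ] (1# - q ^ suc (toℕ j))

  Î : K^× → (K^× → Carrier) → (K^× → Carrier)
  Î q g x = val x / q * g (x ÷ q)

  Î^ : ℕ → K^× → (K^× → Carrier) → (K^× → Carrier)
  Î^ m q g = fold g (Î q) m

  eval : ∀ {n} → Vector Carrier n → Carrier → Carrier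
  eval {n} f y = ∑[ i < n ] (f i * y ^ toℕ i)

  -- equivalent to ⟨ q ⁏ n ⟩ # 0#
  NotRootOfUnityUpTo : ℕ → Carrier → Set ℓ₂
  NotRootOfUnityUpTo n q = ∀ j → 1 ≤ j → j ≤ n → q ^ j # 1#

  #1⇒1-#0 : ∀ {x} → x # 1# → 1# - x # 0#
  #1⇒1-#0 {x} x#1 = let y , y*[1-x]≈1 , _ = #⇒invertible (#-sym x#1) in
    invertibleˡ⇒# (y , ≈-trans (*-congˡ (x-0≈x (1# - x))) y*[1-x]≈1)

  product#0 : ∀ {m} (t : Vector Carrier m) → (∀ i → t i # 0#) → product t # 0#
  product#0 {zero}  t t#0 = 1#0
  product#0 {suc m} t t#0 = x#0y#0→xy#0 (t#0 zero) (product#0 (t ∘ suc) (t#0 ∘ suc))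

  module Denominators {n q} (q-reg : NotRootOfUnityUpTo n q) where

    1-q : 1 ≤ n → K^×
    1-q 1≤n = 1# - q , #1⇒1-#0 (#-congʳ (*-identityʳ q) (q-reg 1 ℕ.≤-refl 1≤n))

    ⟨q⁏_⟩ : ∀ m → m ≤ n → K^×
    ⟨q⁏ m ⟩ m≤n = ⟨ q ⁏ m ⟩ , product#0 {m} _ λ j →
      #1⇒1-#0 (q-reg (suc (toℕ j)) (s≤s z≤n) (ℕ.≤-trans (toℕ<n j) m≤n))

  -- The recurrence for c m subtracts the terms with 0 ≤ i < m.  Summing from i = 1 instead would
  -- drop c 0 / ⟨ q ⁏ m ⟩, which is present in the formula for c 1 (as - a * g a / (a * (1 - q)))
  -- and without which the expansion fails already for n = 2 whenever g a # 0#.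
  record IsTaylorCoefficients
    (q : K^×) {n} (q-reg : NotRootOfUnityUpTo n (val q))
    (g : K^× → Carrier) (a : K^×) (c : ℕ → Carrier) : Set ℓ₁ where
    open Denominators q-reg
    field
      c₀ : c 0 ≈ g a
      c₁ : (1≤n : 1 ≤ n) →
           c 1 ≈ (val q * Î q g a - val a * g a) / (a · 1-q 1≤n)
      cₘ : ∀ m → 2 ≤ m → (m≤n : m ≤ n) →
           c m ≈ val q ^ (suc m C 2) * Î^ m q g a / (a ^× m · ⟨q⁏ m ⟩ m≤n)
                 - ∑[ i < m ] (c (toℕ i) / ⟨q⁏ m ∸ toℕ i ⟩ (ℕ.≤-trans (ℕ.m∸n≤m m (toℕ i)) m≤n))

open Numbers public using (ℝ; ℂ; fromℝ; _#ʳ_; 0ʳ; re#; ℂ-heytingField)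
open HeytingField ℂ-heytingField public using () renaming
  (_≈_ to _≈ᶜ_; _#_ to _#ᶜ_; _*_ to _*ᶜ_; 0# to 0ᶜ; 1# to 1ᶜ)
open λ-Calculus ℂ-heytingField public

-- The functions P k x = (x - a)_λ^k satisfy a λ^{-k} x^{-1} P k = P k - P (k + 1), so Horner's rule
-- turns any polynomial in x^{-1} into a combination of them.  At the nodes x = a / λ^m the value
-- of P k is (λ;λ)_m / (λ;λ)_{m-k} for k ≤ m and 0 for k > m, while the m-fold λ-integral at a is
-- a^m λ^{- binom(m+1, 2)} times the value at a / λ^m.  Evaluating the expansion at the nodes is
-- therefore a triangular system, and that system is the recurrence for the coefficients.
module Submission where

open import Algebra.Apartness.Bundles using (HeytingCommutativeRing; HeytingField)
import Algebra.Apartness.Properties.HeytingCommutativeRing as HeytingCommutativeRingProperties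
open import Algebra.Bundles using (CommutativeRing; Monoid)
import Algebra.Definitions.RawMonoid as RawMonoidDefinitions
import Algebra.Properties.Semiring.Exp as Exp
import Algebra.Properties.Semiring.Sum as Sum
import Algebra.Solver.Ring.NaturalCoefficients.Default as SemiringSolver
open import Data.Fin.Base as Fin using (fromℕ; toℕ)
open import Data.Fin.Properties using (toℕ<n)
open import Data.Nat.Base as ℕ using (ℕ; suc)
open import Data.Nat.Combinatorics using (_C_; nC1≡n; nCk+nC[k+1]≡[n+1]C[k+1])
import Data.Nat.Properties as ℕ
open import Data.Product.Base using (_×_; _,_; ∃-syntax; proj₁; proj₂)
open import Data.Vec.Functional using (Vector)
open import Function.Base using (_∘_)
import Relation.Binary.PropositionalEquality.Core as ≡
import Relation.Binary.Reasoning.Setoid as SetoidReasoning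

open import Defs using (module λ-Calculus)

-- Finite sums over a monoid, split at the last index

module MonoidSums {c ℓ} (M : Monoid c ℓ) where

  open Monoid M
  open RawMonoidDefinitions rawMonoid using (sum)
  open SetoidReasoning setoid

  -- `sum` unfolds at index 0, while the recursions in k and m append at the end. The setting is a
  -- bare monoid, so that products are covered as well as sums.
  sum-last : ∀ (t : ℕ → Carrier) n → sum {suc n} (t ∘ toℕ) ≈ sum {n} (t ∘ toℕ) ∙ t n
  sum-last t ℕ.zero = trans (identityʳ (t 0)) (sym (identityˡ (t 0)))
  sum-last t (suc n) = begin
    t 0 ∙ sum {suc n} (t ∘ suc ∘ toℕ)             ≈⟨ ∙-congˡ (sum-last (t ∘ suc) n) ⟩
    t 0 ∙ (sum {n} (t ∘ suc ∘ toℕ) ∙ t (suc n))  ≈⟨ assoc _ _ _ ⟨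
    t 0 ∙ sum {n} (t ∘ suc ∘ toℕ) ∙ t (suc n)    ∎

  -- Cuts the expansion off where the functions `P k` vanish at a node. With `≤′` the recursion
  -- removes one last term at a time.
  sum-truncate : ∀ (t : ℕ → Carrier) {m n} → m ℕ.≤′ n → (∀ k → m ℕ.≤ k → t k ≈ ε) →
                 sum {n} (t ∘ toℕ) ≈ sum {m} (t ∘ toℕ)
  sum-truncate t (ℕ.≤′-reflexive ≡.refl) t≈ε = refl
  sum-truncate t {m} (ℕ.≤′-step {n} m≤n) t≈ε = begin
    sum {suc n} (t ∘ toℕ)    ≈⟨ sum-last t n ⟩
    sum {n} (t ∘ toℕ) ∙ t n  ≈⟨ ∙-cong (sum-truncate t m≤n t≈ε) (t≈ε n (ℕ.≤′⇒≤ m≤n)) ⟩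
    sum {m} (t ∘ toℕ) ∙ ε    ≈⟨ identityʳ _ ⟩
    sum {m} (t ∘ toℕ)        ∎

module TaylorExpansion {c ℓ₁ ℓ₂} (K : HeytingField c ℓ₁ ℓ₂) where

  open HeytingField K using (heytingCommutativeRing; #⇒invertible)
  open HeytingCommutativeRingProperties heytingCommutativeRing using (x-0≈x)
  open CommutativeRing (HeytingCommutativeRing.commutativeRing heytingCommutativeRing)
  open λ-Calculus K
  open Exp semiring using (^-homo-*; ^-congʳ)
  open Sum semiring using (sum-cong-≋; *-distribˡ-sum; *-distribʳ-sum)
  open MonoidSums +-monoid using (sum-last; sum-truncate)
  open MonoidSums *-monoid using () renaming (sum-last to product-last)
  open SemiringSolver commutativeSemiring
  open SetoidReasoning setoid

  -- Cancellation laws for division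

  ⁻¹-inverseʳ : ∀ x → val x * x ⁻¹ ≈ 1#
  ⁻¹-inverseʳ (x , x#0) =
    trans (*-congʳ (sym (x-0≈x x))) (proj₂ (proj₂ (#⇒invertible x#0)))

  /-*-cancel : ∀ x y → x / y * val y ≈ x
  /-*-cancel x y = begin
    x * y ⁻¹ * val y    ≈⟨ solve 3 (λ x i y → x :* i :* y := x :* (y :* i)) refl x (y ⁻¹) (val y) ⟩
    x * (val y * y ⁻¹)  ≈⟨ *-congˡ (⁻¹-inverseʳ y) ⟩
    x * 1#              ≈⟨ *-identityʳ x ⟩
    x                   ∎

  *≈⇒≈/ : ∀ {x z} y → x * val y ≈ z → x ≈ z / y
  *≈⇒≈/ {x} {z} y xy≈z = begin
    x                   ≈⟨ *-identityʳ x ⟨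
    x * 1#              ≈⟨ *-congˡ (⁻¹-inverseʳ y) ⟨
    x * (val y * y ⁻¹)  ≈⟨ *-assoc _ _ _ ⟨
    x * val y * y ⁻¹    ≈⟨ *-congʳ xy≈z ⟩
    z / y               ∎

  +≈⇒≈- : ∀ {x y z} → x + y ≈ z → x ≈ z - y
  +≈⇒≈- {x} {y} {z} x+y≈z = begin
    x            ≈⟨ +-identityʳ x ⟨
    x + 0#       ≈⟨ +-congˡ (-‿inverseʳ y) ⟨
    x + (y - y)  ≈⟨ +-assoc _ _ _ ⟨
    x + y - y    ≈⟨ +-congʳ x+y≈z ⟩
    z - y        ∎

  -+-cancel : ∀ x y → x - y + y ≈ x
  -+-cancel x y = begin
    x - y + y      ≈⟨ +-assoc _ _ _ ⟩
    x + (- y + y)  ≈⟨ +-congˡ (-‿inverseˡ y) ⟩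
    x + 0#         ≈⟨ +-identityʳ x ⟩
    x              ∎

  val-^× : ∀ x n → val (x ^× n) ≈ val x ^ n
  val-^× x ℕ.zero  = refl
  val-^× x (suc n) = *-congˡ (val-^× x n)

  -- The functions (x - a)_λ^k and the products (λ;λ)_m

  module Powers (q a : K^×) where

    P : ℕ → K^× → Carrier
    P k x = ⟨ x - val a ⟩[ q ]^ k

    D : ℕ → Carrier
    D m = ⟨ val q ⁏ m ⟩

    ratio : K^× → ℕ → Carrier
    ratio x k = val a / (q ^× k · x)

    P-suc : ∀ k x → P (suc k) x ≈ P k x * (1# - ratio x k)
    P-suc k x = product-last (λ j → 1# - ratio x j) k

    D-suc : ∀ m → D (suc m) ≈ D m * (1# - val q ^ suc m)
    D-suc = product-last (λ j → 1# - val q ^ suc j)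

    -- The factor by which x⁻¹ P k is a multiple of P k - P (k + 1).
    scale : ℕ → Carrier
    scale k = val (q ^× k) / a

    scale-ratio : ∀ k x → scale k * ratio x k ≈ x ⁻¹
    scale-ratio k x = begin
      scale k * ratio x k       ≈⟨ *≈⇒≈/ x clear ⟩
      1# * x ⁻¹                 ≈⟨ *-identityˡ _ ⟩
      x ⁻¹                      ∎
      where
      y = q ^× k · x

      clear : scale k * ratio x k * val x ≈ 1#
      clear = begin
        val (q ^× k) * a ⁻¹ * (val a * y ⁻¹) * val x
          ≈⟨ solve 5 (λ Q i A r X → Q :* i :* (A :* r) :* X := (A :* i) :* (Q :* X :* r)) refl
               (val (q ^× k)) (a ⁻¹) (val a) (y ⁻¹) (val x) ⟩
        (val a * a ⁻¹) * (val y * y ⁻¹)  ≈⟨ *-cong (⁻¹-inverseʳ a) (⁻¹-inverseʳ y) ⟩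
        1# * 1#                          ≈⟨ *-identityˡ _ ⟩
        1#                               ∎

    -- Expand the last factor of `P (suc k) x`; by `scale-ratio` its subtracted part becomes `x ⁻¹`
    -- once scaled. The form without subtraction suits the semiring solver.
    ⁻¹*P : ∀ k x → scale k * P k x ≈ scale k * P (suc k) x + x ⁻¹ * P k x
    ⁻¹*P k x = begin
      s * p                            ≈⟨ *-congʳ (*-identityʳ s) ⟨
      s * 1# * p                       ≈⟨ *-congʳ (*-congˡ (-+-cancel 1# u)) ⟨
      s * (1# - u + u) * p
        ≈⟨ solve 4 (λ s v u p → s :* (v :+ u) :* p := s :* (p :* v) :+ s :* u :* p) refl
             s (1# - u) u p ⟩
      s * (p * (1# - u)) + s * u * p
        ≈⟨ +-cong (*-congˡ (sym (P-suc k x))) (*-congʳ (scale-ratio k x)) ⟩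
      s * P (suc k) x + x ⁻¹ * p       ∎
      where
      s = scale k
      p = P k x
      u = ratio x k

    -- Expansion of polynomials in 1/x

    -- Horner's rule: multiplying the expansion of the tail by `x ⁻¹` replaces each `P k` by
    -- `scale k` times `P k - P (suc k)`, and terms of equal index are collected. The indices run
    -- over all of ℕ, with value 0 past the end.
    coefficients : ∀ {n} → Vector Carrier n → ℕ → Carrier
    coefficients {ℕ.zero} f k       = 0#
    coefficients {suc n}  f ℕ.zero  = f Fin.zero + coefficients (f ∘ Fin.suc) 0 * scale 0
    coefficients {suc n}  f (suc k) =
      coefficients (f ∘ Fin.suc) (suc k) * scale (suc k) - coefficients (f ∘ Fin.suc) k * scale k

    coefficients≈0 : ∀ {n} (f : Vector Carrier n) k → n ℕ.≤ k → coefficients f k ≈ 0#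
    coefficients≈0 {ℕ.zero} f k       _           = refl
    coefficients≈0 {suc n}  f (suc k) (ℕ.s≤s n≤k) = begin
      e (suc k) * scale (suc k) - e k * scale k
        ≈⟨ +-cong (*-congʳ (coefficients≈0 (f ∘ Fin.suc) (suc k) (ℕ.m≤n⇒m≤1+n n≤k)))
                  (-‿cong (*-congʳ (coefficients≈0 (f ∘ Fin.suc) k n≤k))) ⟩
      0# * scale (suc k) - 0# * scale k  ≈⟨ +-cong (zeroˡ _) (-‿cong (zeroˡ _)) ⟩
      0# - 0#                            ≈⟨ -‿inverseʳ 0# ⟩
      0#                                 ∎
      where e = coefficients (f ∘ Fin.suc)

    -- Summation by parts against ⁻¹*P.
    by-parts : ∀ (e : ℕ → Carrier) x n →
      e 0 * scale 0 * P 0 x +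
        ∑[ k < n ] ((e (suc (toℕ k)) * scale (suc (toℕ k)) - e (toℕ k) * scale (toℕ k)) * P (suc (toℕ k)) x)
      ≈ x ⁻¹ * ∑[ k < n ] (e (toℕ k) * P (toℕ k) x) + e n * scale n * P n x
    by-parts e x ℕ.zero = solve 2 (λ i t → t :+ con 0 := i :* con 0 :+ t) refl _ _
    by-parts e x (suc n) = begin
      d 0 * P 0 x + ∑[ k < suc n ] (Δ (toℕ k))
        ≈⟨ +-congˡ (sum-last Δ n) ⟩
      d 0 * P 0 x + (∑[ k < n ] (Δ (toℕ k)) + Δ n)
        ≈⟨ +-assoc _ _ _ ⟨
      d 0 * P 0 x + ∑[ k < n ] (Δ (toℕ k)) + Δ n
        ≈⟨ +-congʳ (by-parts e x n) ⟩
      x ⁻¹ * S + e n * scale n * P n x + Δ n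
        -- `⁻¹*P` splits the boundary term: one part is the next summand, the other telescopes with
        -- `Δ n` into the new boundary term.
        ≈⟨ +-congʳ (+-congˡ (trans (*-assoc _ _ _) (*-congˡ (⁻¹*P n x)))) ⟩
      x ⁻¹ * S + e n * (scale n * p + x ⁻¹ * P n x) + Δ n
        ≈⟨ solve 7 (λ i S e s p r v →
               i :* S :+ e :* (s :* p :+ i :* r) :+ v :* p := i :* (S :+ e :* r) :+ (v :+ e :* s) :* p)
             refl (x ⁻¹) S (e n) (scale n) p (P n x) (d (suc n) - d n) ⟩
      x ⁻¹ * (S + e n * P n x) + (d (suc n) - d n + d n) * p
        ≈⟨ +-cong (*-congˡ (sym (sum-last (λ k → e k * P k x) n))) (*-congʳ (-+-cancel _ _)) ⟩
      x ⁻¹ * ∑[ k < suc n ] (e (toℕ k) * P (toℕ k) x) + d (suc n) * p ∎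
      where
      d : ℕ → Carrier
      d k = e k * scale k
      Δ : ℕ → Carrier
      Δ k = (d (suc k) - d k) * P (suc k) x
      S = ∑[ k < n ] (e (toℕ k) * P (toℕ k) x)
      p = P (suc n) x

    eval-suc : ∀ {n} (f : Vector Carrier (suc n)) y → eval f y ≈ f Fin.zero + y * eval (f ∘ Fin.suc) y
    eval-suc f y = +-cong (*-identityʳ _) (begin
      ∑[ i < _ ] (f (Fin.suc i) * (y * y ^ toℕ i))
        ≈⟨ sum-cong-≋ (λ i → solve 3 (λ f y z → f :* (y :* z) := y :* (f :* z)) refl
             (f (Fin.suc i)) y (y ^ toℕ i)) ⟩
      ∑[ i < _ ] (y * (f (Fin.suc i) * y ^ toℕ i))
        ≈⟨ *-distribˡ-sum y (λ i → f (Fin.suc i) * y ^ toℕ i) ⟨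
      y * eval (f ∘ Fin.suc) y ∎)

    expansion : ∀ {n} (f : Vector Carrier n) x →
                eval f (x ⁻¹) ≈ ∑[ k < n ] (coefficients f (toℕ k) * P (toℕ k) x)
    expansion {ℕ.zero} f x = refl
    expansion {suc n}  f x = begin
      eval f (x ⁻¹)                             ≈⟨ eval-suc f (x ⁻¹) ⟩
      f₀ + x ⁻¹ * eval (f ∘ Fin.suc) (x ⁻¹)     ≈⟨ +-congˡ (*-congˡ (expansion (f ∘ Fin.suc) x)) ⟩
      f₀ + x ⁻¹ * S                             ≈⟨ +-congˡ (+-identityʳ _) ⟨
      -- The boundary term of `by-parts` comes for free: the tail has n entries, so its coefficient
      -- of index n is 0.
      f₀ + (x ⁻¹ * S + 0#)                      ≈⟨ +-congˡ (+-congˡ top≈0) ⟨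
      f₀ + (x ⁻¹ * S + e n * scale n * P n x)   ≈⟨ +-congˡ (by-parts e x n) ⟨
      f₀ + (e 0 * scale 0 * 1# + T)
        ≈⟨ solve 3 (λ f s t → f :+ (s :* con 1 :+ t) := (f :+ s) :* con 1 :+ t) refl f₀ (e 0 * scale 0) T ⟩
      (f₀ + e 0 * scale 0) * 1# + T             ∎
      where
      e = coefficients (f ∘ Fin.suc)
      f₀ = f Fin.zero
      S = ∑[ k < n ] (e (toℕ k) * P (toℕ k) x)
      T = ∑[ k < n ] (coefficients f (suc (toℕ k)) * P (suc (toℕ k)) x)

      top≈0 : e n * scale n * P n x ≈ 0#
      top≈0 = begin
        e n * scale n * P n x  ≈⟨ *-congʳ (*-congʳ (coefficients≈0 (f ∘ Fin.suc) n ℕ.≤-refl)) ⟩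
        0# * scale n * P n x   ≈⟨ solve 2 (λ s p → con 0 :* s :* p := con 0) refl (scale n) (P n x) ⟩
        0#                     ∎

    -- Values at the nodes a / λ^m

    -- x / q ^ m, with the divisions in the order in which Î^ performs them
    node : K^× → ℕ → K^×
    node x ℕ.zero  = x
    node x (suc m) = node (x ÷ q) m

    q^*node : ∀ x m → val q ^ m * val (node x m) ≈ val x
    q^*node x ℕ.zero  = *-identityˡ _
    q^*node x (suc m) = begin
      val q * val q ^ m * val (node (x ÷ q) m)    ≈⟨ *-assoc _ _ _ ⟩
      val q * (val q ^ m * val (node (x ÷ q) m))  ≈⟨ *-congˡ (q^*node (x ÷ q) m) ⟩
      val q * (val x / q)                         ≈⟨ *-comm _ _ ⟩
      val x / q * val q                           ≈⟨ /-*-cancel (val x) q ⟩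
      val x                                       ∎

    -- The power q^k cancels against the q^m in the node. An explicit complement `l` takes the place
    -- of a truncated difference m - k.
    ratio-node : ∀ k l {m} → k ℕ.+ l ≡.≡ m → ratio (node a m) k ≈ val q ^ l
    ratio-node k l {m} k+l≡m = sym (*≈⇒≈/ (q ^× k · node a m) (begin
      val q ^ l * (val (q ^× k) * v)  ≈⟨ *-congˡ (*-congʳ (val-^× q k)) ⟩
      val q ^ l * (val q ^ k * v)
        ≈⟨ solve 3 (λ l k v → l :* (k :* v) := (k :* l) :* v) refl (val q ^ l) (val q ^ k) v ⟩
      val q ^ k * val q ^ l * v       ≈⟨ *-congʳ (^-homo-* (val q) k l) ⟨
      val q ^ (k ℕ.+ l) * v           ≈⟨ *-congʳ (^-congʳ (val q) k+l≡m) ⟩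
      val q ^ m * v                   ≈⟨ q^*node a m ⟩
      val a                           ∎))
      where v = val (node a m)

    -- At the node the factors of `P k` are 1 - q^(m-j) for j < k, the top k factors of `D m`. The
    -- induction hands one factor at a time from `P` to `D`; the product form avoids division.
    P-node : ∀ k l {m} → k ℕ.+ l ≡.≡ m → P k (node a m) * D l ≈ D m
    P-node ℕ.zero  l ≡.refl  = *-identityˡ _
    P-node (suc k) l {m} k+l≡m = begin
      P (suc k) x * D l                   ≈⟨ *-congʳ (P-suc k x) ⟩
      P k x * (1# - ratio x k) * D l
        ≈⟨ *-congʳ (*-congˡ (+-congˡ (-‿cong (ratio-node k (suc l) k+1+l≡m)))) ⟩
      P k x * (1# - val q ^ suc l) * D l
        ≈⟨ solve 3 (λ p u d → p :* u :* d := p :* (d :* u)) refl (P k x) (1# - val q ^ suc l) (D l) ⟩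
      P k x * (D l * (1# - val q ^ suc l))  ≈⟨ *-congˡ (D-suc l) ⟨
      P k x * D (suc l)                     ≈⟨ P-node k (suc l) k+1+l≡m ⟩
      D m                                   ∎
      where
      x = node a m
      k+1+l≡m = ≡.trans (ℕ.+-suc k l) k+l≡m

    P-node-self : ∀ m → P m (node a m) ≈ D m
    P-node-self m = trans (sym (*-identityʳ _)) (P-node m 0 (ℕ.+-identityʳ m))

    -- The factor with j = m is 1 - q^0 = 0 at this node, and every later product contains it.
    P-node≈0 : ∀ {m k} → suc m ℕ.≤′ k → P k (node a m) ≈ 0#
    P-node≈0 {m} (ℕ.≤′-reflexive ≡.refl) = begin
      P (suc m) x                 ≈⟨ P-suc m x ⟩
      P m x * (1# - ratio x m)
        ≈⟨ *-congˡ (+-congˡ (-‿cong (ratio-node m 0 (ℕ.+-identityʳ m)))) ⟩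
      P m x * (1# - 1#)           ≈⟨ *-congˡ (-‿inverseʳ 1#) ⟩
      P m x * 0#                  ≈⟨ zeroʳ _ ⟩
      0#                          ∎
      where x = node a m
    P-node≈0 {m} (ℕ.≤′-step {k} m<k) = begin
      P (suc k) (node a m)  ≈⟨ P-suc k _ ⟩
      P k (node a m) * _    ≈⟨ *-congʳ (P-node≈0 m<k) ⟩
      0# * _                ≈⟨ zeroˡ _ ⟩
      0#                    ∎

    -- Row m of the triangular system, with the diagonal term set apart because the recurrence
    -- solves for it. The bound m ≤ n keeps that term within the expansion.
    expansion-node : ∀ {n} (f : Vector Carrier (suc n)) m → m ℕ.≤ n →
      coefficients f m * D m + ∑[ i < m ] (coefficients f (toℕ i) * P (toℕ i) (node a m))
      ≈ eval f (node a m ⁻¹)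
    expansion-node {n} f m m≤n = begin
      coefficients f m * D m + S        ≈⟨ +-congʳ (*-congˡ (P-node-self m)) ⟨
      t m + S                           ≈⟨ +-comm _ _ ⟩
      S + t m                           ≈⟨ sum-last t m ⟨
      ∑[ k < suc m ] (t (toℕ k))
        ≈⟨ sum-truncate t (ℕ.≤⇒≤′ (ℕ.s≤s m≤n))
             (λ k m<k → trans (*-congˡ (P-node≈0 (ℕ.≤⇒≤′ m<k))) (zeroʳ _)) ⟨
      ∑[ k < suc n ] (t (toℕ k))        ≈⟨ expansion f (node a m) ⟨
      eval f (node a m ⁻¹)              ∎
      where
      t : ℕ → Carrier
      t k = coefficients f k * P k (node a m)
      S = ∑[ i < m ] (t (toℕ i))

    -- Iterated λ-integrals at the nodes

    suc-C-2 : ∀ m → suc (suc m) C 2 ≡.≡ suc m ℕ.+ suc m C 2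
    suc-C-2 m = ≡.trans (≡.sym (nCk+nC[k+1]≡[n+1]C[k+1] (suc m) 1)) (≡.cong (ℕ._+ suc m C 2) (nC1≡n (suc m)))

    -- Peeling off the outermost `Î` moves the argument from x to x / q, so the induction on m is
    -- over all `x`.
    Î^-node : ∀ m g x → val q ^ (suc m C 2) * Î^ m q g x ≈ val x ^ m * g (node x m)
    Î^-node ℕ.zero  g x = refl
    Î^-node (suc m) g x = begin
      -- Pascal's rule frees m + 1 factors q, exactly enough to turn `val y ^ suc m` back into
      -- `val x ^ suc m`.
      val q ^ (suc (suc m) C 2) * (val y * I)        ≈⟨ *-congʳ (^-congʳ (val q) (suc-C-2 m)) ⟩
      val q ^ (suc m ℕ.+ suc m C 2) * (val y * I)    ≈⟨ *-congʳ (^-homo-* (val q) (suc m) (suc m C 2)) ⟩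
      val q ^ suc m * val q ^ (suc m C 2) * (val y * I)
        ≈⟨ solve 4 (λ u w y i → u :* w :* (y :* i) := u :* y :* (w :* i)) refl
             (val q ^ suc m) (val q ^ (suc m C 2)) (val y) I ⟩
      val q ^ suc m * val y * (val q ^ (suc m C 2) * I)  ≈⟨ *-congˡ (Î^-node m g y) ⟩
      val q ^ suc m * val y * (val y ^ m * G)
        ≈⟨ solve 4 (λ u y z g → u :* y :* (z :* g) := u :* (y :* z) :* g) refl
             (val q ^ suc m) (val y) (val y ^ m) G ⟩
      val q ^ suc m * val y ^ suc m * G              ≈⟨ *-congʳ (q^*y^ (suc m)) ⟩
      val x ^ suc m * G                              ∎
      where
      y = x ÷ q
      I = Î^ m q g y
      G = g (node y m)

      q^*y^ : ∀ n → val q ^ n * val y ^ n ≈ val x ^ n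
      q^*y^ ℕ.zero  = *-identityˡ _
      q^*y^ (suc n) = begin
        val q * val q ^ n * (val y * val y ^ n)
          ≈⟨ solve 4 (λ q r y z → q :* r :* (y :* z) := y :* q :* (r :* z)) refl
               (val q) (val q ^ n) (val y) (val y ^ n) ⟩
        val y * val q * (val q ^ n * val y ^ n)  ≈⟨ *-cong (/-*-cancel (val x) q) (q^*y^ n) ⟩
        val x * val x ^ n                        ∎

    -- The recurrence for the coefficients

    -- Each field is a row of the triangular system solved for its diagonal coefficient; `q-reg`
    -- makes the denominators invertible.
    coefficients-taylor : ∀ {n} (q-reg : NotRootOfUnityUpTo n (val q)) (f : Vector Carrier (suc n)) →
      IsTaylorCoefficients q q-reg (λ x → eval f (x ⁻¹)) a (coefficients f)
    coefficients-taylor {n} q-reg f = record { c₀ = c₀ ; c₁ = c₁ ; cₘ = cₘ }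
      where
      open Denominators q-reg

      e = coefficients f

      g : K^× → Carrier
      g x = eval f (x ⁻¹)

      c₀ : e 0 ≈ g a
      c₀ = begin
        e 0            ≈⟨ solve 1 (λ e → e := e :* con 1 :+ con 0) refl (e 0) ⟩
        e 0 * 1# + 0#  ≈⟨ expansion-node f 0 ℕ.z≤n ⟩
        g a            ∎

      c₁ : (1≤n : 1 ℕ.≤ n) → e 1 ≈ (val q * Î q g a - val a * g a) / (a · 1-q 1≤n)
      c₁ 1≤n = *≈⇒≈/ (a · 1-q 1≤n) (+≈⇒≈- (begin
        e 1 * (val a * (1# - val q)) + val a * g a
          ≈⟨ +-congˡ (*-congˡ c₀) ⟨
        e 1 * (val a * (1# - val q)) + val a * e 0
          -- The factor of `D 1` is 1 - q^1, so `val q` takes that form. The solver's `con 1` and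
          -- `con 0` below are the empty products and the empty sum.
          ≈⟨ +-congʳ (*-congˡ (*-congˡ (+-congˡ (-‿cong (*-identityʳ (val q)))))) ⟨
        e 1 * (val a * (1# - val q ^ 1)) + val a * e 0
          ≈⟨ solve 4 (λ e a u z → e :* (a :* u) :+ a :* z
                 := a :* (e :* (u :* con 1) :+ (z :* con 1 :+ con 0))) refl
               (e 1) (val a) (1# - val q ^ 1) (e 0) ⟩
        val a * (e 1 * D 1 + (e 0 * 1# + 0#))  ≈⟨ *-congˡ (expansion-node f 1 1≤n) ⟩
        val a * g (a ÷ q)                      ≈⟨ *-congʳ (/-*-cancel (val a) q) ⟨
        val a / q * val q * g (a ÷ q)
          ≈⟨ solve 3 (λ y q g → y :* q :* g := q :* (y :* g)) refl (val a / q) (val q) (g (a ÷ q)) ⟩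
        val q * Î q g a                        ∎))

      cₘ : ∀ m → 2 ℕ.≤ m → (m≤n : m ℕ.≤ n) →
           e m ≈ val q ^ (suc m C 2) * Î^ m q g a / (a ^× m · ⟨q⁏ m ⟩ m≤n)
                 - ∑[ i < m ] (e (toℕ i) / ⟨q⁏ m ℕ.∸ toℕ i ⟩ (ℕ.≤-trans (ℕ.m∸n≤m m (toℕ i)) m≤n))
      cₘ m _ m≤n = +≈⇒≈- (*≈⇒≈/ (a ^× m · ⟨q⁏ m ⟩ m≤n) (begin
        (e m + ∑[ i < m ] (t i)) * (val (a ^× m) * D m)
          ≈⟨ solve 4 (λ e S a d → (e :+ S) :* (a :* d) := a :* (e :* d :+ S :* d)) refl
               (e m) (∑[ i < m ] (t i)) (val (a ^× m)) (D m) ⟩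
        val (a ^× m) * (e m * D m + ∑[ i < m ] (t i) * D m)
          ≈⟨ *-cong (val-^× a m) (+-congˡ (trans (*-distribʳ-sum (D m) t) (sum-cong-≋ t*D))) ⟩
        val a ^ m * (e m * D m + ∑[ i < m ] (e (toℕ i) * P (toℕ i) (node a m)))
          ≈⟨ *-congˡ (expansion-node f m m≤n) ⟩
        val a ^ m * g (node a m)
          ≈⟨ Î^-node m g a ⟨
        val q ^ (suc m C 2) * Î^ m q g a ∎))
        where
        d : Fin.Fin m → K^×
        d i = ⟨q⁏ m ℕ.∸ toℕ i ⟩ (ℕ.≤-trans (ℕ.m∸n≤m m (toℕ i)) m≤n)

        t : Vector Carrier m
        t i = e (toℕ i) / d i

        -- `P-node` factors `D m` into the value of `P` and the denominator `d i`, which cancels;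
        -- the quotients of the recurrence thus become the entries of row m.
        t*D : ∀ i → t i * D m ≈ e (toℕ i) * P (toℕ i) (node a m)
        t*D i = begin
          t i * D m
            ≈⟨ *-congˡ (P-node (toℕ i) (m ℕ.∸ toℕ i) (ℕ.m+[n∸m]≡n (ℕ.<⇒≤ (toℕ<n i)))) ⟨
          t i * (P (toℕ i) (node a m) * val (d i))
            ≈⟨ solve 3 (λ t p d → t :* (p :* d) := t :* d :* p) refl (t i) (P (toℕ i) (node a m)) (val (d i)) ⟩
          t i * val (d i) * P (toℕ i) (node a m)
            ≈⟨ *-congʳ (/-*-cancel (e (toℕ i)) (d i)) ⟩
          e (toℕ i) * P (toℕ i) (node a m) ∎

open import Defs

theorem4 : (q : ℂ) (q#0 : q #ᶜ 0ᶜ) (n : ℕ) (q-reg : NotRootOfUnityUpTo n q)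
    (f : Vector ℂ (suc n)) → f (fromℕ n) #ᶜ 0ᶜ →
    (a : ℝ) (a#0 : a #ʳ 0ʳ) →
    ∃[ c ] IsTaylorCoefficients (q , q#0) q-reg (λ x → eval f (x ⁻¹)) (fromℝ a , re# a#0) c ×
    ((x : K^×) → eval f (x ⁻¹) ≈ᶜ ∑[ k ≤ n ] (c (toℕ k) *ᶜ ⟨ x - fromℝ a ⟩[ q , q#0 ]^ toℕ k))
theorem4 q q#0 n q-reg f _ a a#0 = coefficients f , coefficients-taylor q-reg f , expansion f
  where open TaylorExpansion.Powers ℂ-heytingField (q , q#0) (fromℝ a , re# a#0)
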